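{- Let $k\ge 2$, let $U$ be a finite nonempty set, and let $f:\{0,\ldots,k\}^U\to\mathbb{R}_{+}$ be submodular in every orthant and $k$-wise monotone. Let $\mathbf{o}$ be an orthant of $U$ that maximizes $f$, and let $\mathbf{s}$ be the (random) orthant produced by the randomized greedy algorithm on $f$ (for an arbitrary processing order of $U$). Then \[\left(1+\sqrt{\tfrac{k}{2}}\right)\mathbb{E}[f(\mathbf{s})]\ \ge\ f(\mathbf{o}).\]
   Context: $\mathbb{R}_{+}$ denotes the non-negative reals. For $s,t\in\{0,\ldots,k\}$ define $\mathrm{min}_0(s,t)=0$ if $s\neq 0$, $t\neq 0$ and $s\neq t$, and $\mathrm{min}_0(s,t)=\min(s,t)$ otherwise; define $\mathrm{max}_0(s,t)=0$ if $s\neq 0$, $t\neq 0$ and $s\neq t$, and $\mathrm{max}_0(s,t)=\max(s,t)$ otherwise. Both are applied coordinate-wise to vectors. Vectors in $\{0,\ldots,k\}^U$ are called partial solutions; an orthant is a vector $\mathbf{x}\in\{1,\ldots,k\}^U$. A partial solution $\mathbf{s}$ is in orthant $\mathbf{x}$ if $s_e\in\{0,x_e\}$ for all $e\in U$. $f$ is submodular in every orthant if for any two partial solutions $\mathbf{a},\mathbf{b}$ in a common orthant, $f(\mathbf{a})+f(\mathbf{b})\ge f(\mathrm{min}_0(\mathbf{a},\mathbf{b}))+f(\mathrm{max}_0(\mathbf{a},\mathbf{b}))$. For $e\in U$, $i\in\{1,\ldots,k\}$ and $\mathbf{s}$ with $s_e=0$, let $f_{i,e}(\mathbf{s})=f(\mathbf{s}+i\cdot\mathbf{1}_e)-f(\mathbf{s})$,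 where $\mathbf{1}_e$ is the unit vector of coordinate $e$. $f$ is $k$-wise monotone if $\sum_{i=1}^k f_{i,e}(\mathbf{s})\ge 0$ for every $e\in U$ and every $\mathbf{s}$ with $s_e=0$. Randomized greedy algorithm: start with $\mathbf{s}=\mathbf{0}$. Process the elements of $U$ one at a time in an arbitrary fixed order; when processing $e$, compute $y_i=\max(0,f_{i,e}(\mathbf{s}))$ for $i=1,\ldots,k$ with respect to the current $\mathbf{s}$ and let $\beta=\sum_{i=1}^k y_i$. If $\beta\neq 0$, choose $q\in\{1,\ldots,k\}$ at random with $\Pr[q=\ell]=y_\ell/\beta$ (with fresh randomness, given the past) and permanently set $s_e\gets q$; if $\beta=0$, set $s_e\gets 1$. After all elements have been processed, return $\mathbf{s}$. -}

module Defs where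

open import Algebra.Bundles using (CommutativeRing)
open import Data.Bool.Base using (if_then_else_)
open import Data.Fin.Base using (Fin; zero; suc; fromℕ<)
import Data.Fin.Properties as Fin
open import Data.List.Base as List using (List; []; _∷_)
open import Data.Nat.Base using (ℕ; suc; NonTrivial; >-nonZero⁻¹; nonTrivial⇒nonZero)
open import Data.Product.Base using (_×_; _,_; ∃)
open import Data.Sum.Base using (_⊎_)
open import Data.Vec.Base using (Vec; lookup; zipWith; replicate; _[_]≔_)
open import Level using (Level; _⊔_) renaming (suc to lsuc)
open import Relation.Binary.Bundles using (DecTotalOrder)
open import Relation.Binary.Core using (Rel)
open import Relation.Binary.PropositionalEquality.Core using (_≡_; _≢_)
open import Relation.Binary.Structures using (IsDecTotalOrder)
open import Relation.Nullary using (¬_)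
open import Relation.Nullary.Decidable using (⌊_⌋; ¬?; _×-dec_)
open import Relation.Unary using (Pred; Satisfiable)

import Algebra.Construct.NaturalChoice.Max as Max
import Algebra.Construct.NaturalChoice.Min as Min
import Algebra.Properties.CommutativeMonoid.Sum as Sum
import Algebra.Properties.Monoid.Mult as Mult

private
  variable
    a c ℓ₁ ℓ₂ : Level
    k n : ℕ

record OrderedField c ℓ₁ ℓ₂ : Set (lsuc (c ⊔ ℓ₁ ⊔ ℓ₂)) where
  infix  8 _⁻¹
  infixl 7 _/_
  infix  4 _≤_
  field
    commutativeRing : CommutativeRing c ℓ₁

  open CommutativeRing commutativeRing public
    using (Carrier; _≈_; _+_; _*_; -_; _-_; 0#; 1#; +-monoid; +-commutativeMonoid)

  field
    _≤_             : Rel Carrier ℓ₂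
    -- Decidable, as in classical ℝ: the algorithm branches on β ≟ 0#.
    isDecTotalOrder : IsDecTotalOrder _≈_ _≤_
    +-monoˡ-≤       : ∀ z {x y} → x ≤ y → x + z ≤ y + z
    *-nonNeg        : ∀ {x y} → 0# ≤ x → 0# ≤ y → 0# ≤ x * y
    0≉1             : ¬ 0# ≈ 1#
    -- A total function whose value at 0# is left unspecified.
    _⁻¹             : Carrier → Carrier
    *-inverseʳ      : ∀ {x} → ¬ x ≈ 0# → x * x ⁻¹ ≈ 1#

  decTotalOrder : DecTotalOrder c ℓ₁ ℓ₂
  decTotalOrder = record { isDecTotalOrder = isDecTotalOrder }

  open DecTotalOrder decTotalOrder public using (_≟_; _≤?_; totalOrder)
  open Max totalOrder public using () renaming (_⊔_ to max)
  open Mult +-monoid public using () renaming (_×_ to _·_)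
  open Sum +-commutativeMonoid public using (sum)

  _/_ : Carrier → Carrier → Carrier
  x / y = x * y ⁻¹

  fromℕ : ℕ → Carrier
  fromℕ m = m · 1#

  IsSqrt : Carrier → Carrier → Set (ℓ₁ ⊔ ℓ₂)
  IsSqrt x r = 0# ≤ r × r * r ≈ x

  IsUpperBound : ∀ {p} → Pred Carrier p → Carrier → Set (c ⊔ ℓ₂ ⊔ p)
  IsUpperBound P b = ∀ x → P x → x ≤ b

-- The real numbers, characterised classically up to isomorphism as the
-- Dedekind-complete ordered field.
record Reals c ℓ₁ ℓ₂ : Set (lsuc (c ⊔ ℓ₁ ⊔ ℓ₂)) where
  field
    orderedField : OrderedField c ℓ₁ ℓ₂

  open OrderedField orderedField public

  field
    complete : (P : Pred Carrier (c ⊔ ℓ₁ ⊔ ℓ₂)) →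
               Satisfiable P → ∃ (IsUpperBound P) →
               ∃ λ s → IsUpperBound P s × (∀ b → IsUpperBound P b → s ≤ b)

-- {0,…,k}^U with U = Fin n.
PartialSolution : ℕ → ℕ → Set
PartialSolution k n = Vec (Fin (suc k)) n

IsOrthant : PartialSolution k n → Set
IsOrthant x = ∀ e → lookup x e ≢ zero

_InOrthant_ : PartialSolution k n → PartialSolution k n → Set
s InOrthant x = ∀ e → lookup s e ≡ zero ⊎ lookup s e ≡ lookup x e

module _ {k : ℕ} where
  open Min (Fin.≤-totalOrder (suc k)) using (_⊓_)
  open Max (Fin.≤-totalOrder (suc k)) using () renaming (_⊔_ to _⊔ᶠ_)

  min₀ max₀ : Fin (suc k) → Fin (suc k) → Fin (suc k)
  min₀ s t = if ⌊ ¬? (s Fin.≟ zero) ×-dec ¬? (t Fin.≟ zero) ×-dec ¬? (s Fin.≟ t) ⌋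
             then zero else s ⊓ t
  max₀ s t = if ⌊ ¬? (s Fin.≟ zero) ×-dec ¬? (t Fin.≟ zero) ×-dec ¬? (s Fin.≟ t) ⌋
             then zero else s ⊔ᶠ t

label₁ : .{{NonTrivial k}} → Fin (suc k)
label₁ {k} = suc (fromℕ< (>-nonZero⁻¹ k {{nonTrivial⇒nonZero k}}))

module _ (F : OrderedField c ℓ₁ ℓ₂) where
  open OrderedField F

  NonNegative : (PartialSolution k n → Carrier) → Set ℓ₂
  NonNegative f = ∀ s → 0# ≤ f s

  SubmodularInEveryOrthant : (PartialSolution k n → Carrier) → Set ℓ₂
  SubmodularInEveryOrthant f =
    ∀ x → IsOrthant x → ∀ a b → a InOrthant x → b InOrthant x →
    f (zipWith min₀ a b) + f (zipWith max₀ a b) ≤ f a + f b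

  -- i : Fin k stands for the label suc i ∈ {1,…,k}.  The update agrees with
  -- s + (suc i)·1ₑ when coordinate e of s is zero, the only case of interest.
  marginal : (PartialSolution k n → Carrier) → Fin n → PartialSolution k n →
             Fin k → Carrier
  marginal f e s i = f (s [ e ]≔ suc i) - f s

  KWiseMonotone : (PartialSolution k n → Carrier) → Set ℓ₂
  KWiseMonotone f = ∀ e s → lookup s e ≡ zero → 0# ≤ sum (marginal f e s)

  MaximisingOrthant : (PartialSolution k n → Carrier) → PartialSolution k n → Set ℓ₂
  MaximisingOrthant f o = IsOrthant o × (∀ x → IsOrthant x → f x ≤ f o)

  -- Finite distributions as lists of outcomes weighted by their
  -- probabilities; an outcome may be listed several times.
  Dist : Set a → Set (a ⊔ c)
  Dist A = List (Carrier × A)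

  return : {A : Set a} → A → Dist A
  return x = (1# , x) ∷ []

  _>>=_ : {A B : Set a} → Dist A → (A → Dist B) → Dist B
  d >>= h = List.concatMap (λ (p , x) → List.map (λ (q , y) → p * q , y) (h x)) d

  expectation : {A : Set a} → Dist A → (A → Carrier) → Carrier
  expectation d g = List.foldr (λ (p , x) acc → p * g x + acc) 0# d

  module _ .{{_ : NonTrivial k}} (f : PartialSolution k n → Carrier) where

    greedyStep : Fin n → PartialSolution k n → Dist (PartialSolution k n)
    greedyStep e s =
      if ⌊ β ≟ 0# ⌋
      then return (s [ e ]≔ label₁)
      else List.tabulate (λ i → y i / β , s [ e ]≔ suc i)
      where
      y : Fin k → Carrier
      y i = max 0# (marginal f e s i)

      β : Carrier
      β = sum y

    greedyFrom : PartialSolution k n → List (Fin n) → Dist (PartialSolution k n)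
    greedyFrom s []       = return s
    greedyFrom s (e ∷ es) = greedyStep e s >>= λ s′ → greedyFrom s′ es

    randomizedGreedy : List (Fin n) → Dist (PartialSolution k n)
    randomizedGreedy = greedyFrom (replicate n zero)

-- Let c = √(k/2).  Follow the current solution s together with the hybrid o that
-- agrees with s on the processed elements and with the given orthant elsewhere.
-- Then f(o) + c f(s) does not decrease in expectation; it starts at
-- f(o) + c f(0) ≥ f(o) and ends at (1 + c) f(s).
--
-- When e is processed, let yᵢ be the positive parts of the gains at s, aᵢ the
-- gains at o with coordinate e erased, and j = oₑ.  The step is the inequality
-- Σᵢ yᵢ(aⱼ − aᵢ) ≤ c Σᵢ yᵢ².  Submodularity gives aᵢ ≤ yᵢ and monotonicity gives
-- Σᵢ aᵢ ≥ 0.  If z is the largest yᵢ with i ≠ j, then bounding Σ_{i≠j} (z − yᵢ)aᵢ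
-- by Σ_{i≠j} (z − yᵢ)yᵢ reduces it to (yⱼ + z) Σᵢ yᵢ ≤ (1 + c) Σᵢ yᵢ².
module Submission where

open import Defs
open import Data.Fin.Base using (Fin)
open import Data.List.Base using (List; allFin)
open import Data.List.Relation.Binary.Permutation.Propositional using (_↭_)
open import Data.Nat.Base using (ℕ; NonZero; NonTrivial)

open import Algebra.Bundles using (CommutativeRing)
open import Data.Fin.Base using (zero; suc; punchIn)
import Data.Fin.Properties as Fin
open import Data.List.Base using ([]; _∷_; _++_; map; tabulate)
open import Data.List.Membership.Propositional using (_∈_)
open import Data.List.Membership.Propositional.Properties using (∈-allFin)
open import Data.List.Relation.Binary.Permutation.Propositional using (↭-sym; ↭⇒↭ₛ)
open import Data.List.Relation.Binary.Permutation.Propositional.Properties using (∈-resp-↭)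
import Data.List.Relation.Binary.Permutation.Setoid.Properties as Permutation
open import Data.List.Relation.Unary.All as All using (All; []; _∷_)
open import Data.List.Relation.Unary.AllPairs using ([]; _∷_)
open import Data.List.Relation.Unary.Any using (here; there)
open import Data.List.Relation.Unary.Unique.Propositional using (Unique)
open import Data.List.Relation.Unary.Unique.Propositional.Properties using (allFin⁺)
open import Data.Nat.Base using (suc; z≤n)
open import Data.Product.Base using (_,_; ∃; proj₁; proj₂)
open import Data.Sum.Base using (_⊎_; inj₁; inj₂; [_,_]′; map₁; map₂)
open import Data.Vec.Base using (Vec; lookup; zipWith; replicate; _[_]≔_)
open import Data.Vec.Functional using (Vector; removeAt)
open import Data.Vec.Properties
  using (lookup∘update; lookup∘update′; lookup-zipWith; lookup-replicate;
         []≔-idempotent; []≔-lookup)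
open import Data.Vec.Relation.Binary.Pointwise.Extensional using (ext; Pointwise-≡⇒≡)
open import Function.Base using (_∘_; _$_; id)
open import Level using (Level)
open import Relation.Binary.PropositionalEquality as ≡ using (_≡_; _≢_)
open import Relation.Binary.Structures using (IsDecTotalOrder)
open import Relation.Nullary using (¬_; yes; no; contradiction)

import Algebra.Construct.NaturalChoice.Max as Max
import Algebra.Construct.NaturalChoice.Min as Min
import Algebra.Properties.Semiring.Mult as SemiringMult
import Algebra.Properties.Semiring.Sum as SemiringSum
import Algebra.Solver.Ring.NaturalCoefficients.Default as Solver
import Relation.Binary.Reasoning.Setoid as SetoidReasoning

private
  variable
    ℓ c ℓ₁ ℓ₂ : Level
    A B : Set ℓ
    k n : ℕ

-- Order and arithmetic in an ordered field.

module OrderedFieldProperties (F : OrderedField c ℓ₁ ℓ₂) where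
  open OrderedField F
  open CommutativeRing commutativeRing
    using (commutativeSemiring; semiring; setoid; refl; sym; trans;
           +-cong; +-congˡ; +-congʳ; *-cong; *-congˡ; *-congʳ; +-assoc; +-comm;
           +-identityˡ; +-identityʳ; *-identityˡ; zeroˡ;
           -‿inverseˡ; -‿inverseʳ; *-assoc; *-comm; distribˡ)
  open IsDecTotalOrder isDecTotalOrder public
    using (total; antisym; ≤-respˡ-≈; ≤-respʳ-≈)
    renaming (refl to ≤-refl; trans to ≤-trans; reflexive to ≤-reflexive)
  open SemiringSum semiring
    using (sum-remove; ∑-distrib-+; sum-cong-≋; sum-replicate; *-distribˡ-sum; *-distribʳ-sum)
  open SemiringMult semiring using (×-assoc-*)
  open Solver commutativeSemiring
  open Max totalOrder using (x≤x⊔y; x≤y⊔x)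

  ≤-resp₂ : ∀ {x x′ y y′} → x ≈ x′ → y ≈ y′ → x ≤ y → x′ ≤ y′
  ≤-resp₂ x≈x′ y≈y′ = ≤-respˡ-≈ x≈x′ ∘ ≤-respʳ-≈ y≈y′

  +-mono-≤ : ∀ {x y u v} → x ≤ y → u ≤ v → x + u ≤ y + v
  +-mono-≤ {x} {y} {u} {v} x≤y u≤v =
    ≤-trans (+-monoˡ-≤ u x≤y) (≤-resp₂ (+-comm u y) (+-comm v y) (+-monoˡ-≤ y u≤v))

  x-y+y≈x : ∀ x y → (x - y) + y ≈ x
  x-y+y≈x x y = trans (+-assoc x (- y) y) (trans (+-congˡ (-‿inverseˡ y)) (+-identityʳ x))

  +-cancelʳ-≤ : ∀ z {x y} → x + z ≤ y + z → x ≤ y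
  +-cancelʳ-≤ z {x} {y} x+z≤y+z = ≤-resp₂ (elim x) (elim y) (+-monoˡ-≤ (- z) x+z≤y+z)
    where
    elim : ∀ w → (w + z) - z ≈ w
    elim w = trans (+-assoc w z (- z)) (trans (+-congˡ (-‿inverseʳ z)) (+-identityʳ w))

  -- Linear arithmetic by certificate: with L ≤ R a sum of hypotheses, what is
  -- left to check is an identity without subtraction, within reach of the
  -- semiring solver.
  ≤-by : ∀ {x y l r} → l ≤ r → x + r ≈ y + l → x ≤ y
  ≤-by {x} {y} {l} {r} l≤r x+r≈y+l =
    +-cancelʳ-≤ l (≤-respʳ-≈ x+r≈y+l (+-mono-≤ ≤-refl l≤r))

  x≤y⇒0≤y-x : ∀ {x y} → x ≤ y → 0# ≤ y - x
  x≤y⇒0≤y-x {x} x≤y = ≤-respˡ-≈ (-‿inverseʳ x) (+-monoˡ-≤ (- x) x≤y)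

  -- This is (y - x)(v - u) ≥ 0. The differences enter the solver as atoms p and q, with y = p + x
  -- and v = q + u, since it works without subtraction.
  rearrangement : ∀ {x y u v} → x ≤ y → u ≤ v → x * v + y * u ≤ x * u + y * v
  rearrangement {x} {y} {u} {v} x≤y u≤v =
    ≤-resp₂ (+-cong (*-congˡ v′≈v) (*-congʳ y′≈y)) (+-congˡ (*-cong y′≈y v′≈v)) $
    ≤-by (*-nonNeg (x≤y⇒0≤y-x x≤y) (x≤y⇒0≤y-x u≤v)) $
    solve 4 (λ x u p q → (x :* (q :+ u) :+ (p :+ x) :* u) :+ p :* q
                      := (x :* u :+ (p :+ x) :* (q :+ u)) :+ con 0)
          refl x u (y - x) (v - u)
    where
    y′≈y = x-y+y≈x y x
    v′≈v = x-y+y≈x v u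

  *-monoʳ-≤ : ∀ {z x y} → 0# ≤ z → x ≤ y → z * x ≤ z * y
  *-monoʳ-≤ {z} {x} {y} 0≤z x≤y = ≤-by (rearrangement 0≤z x≤y) $
    solve 3 (λ z x y → z :* x :+ (con 0 :* x :+ z :* y) := z :* y :+ (con 0 :* y :+ z :* x))
          refl z x y

  2xy≤x²+y² : ∀ x y → x * y + y * x ≤ x * x + y * y
  2xy≤x²+y² x y with total x y
  ... | inj₁ x≤y = rearrangement x≤y x≤y
  ... | inj₂ y≤x = ≤-resp₂ (+-comm _ _) (+-comm _ _) (rearrangement y≤x y≤x)

  0≤x² : ∀ x → 0# ≤ x * x
  0≤x² x = ≤-by (2xy≤x²+y² x 0#) $
    solve 1 (λ x → con 0 :+ (x :* x :+ con 0 :* con 0) := x :* x :+ (x :* con 0 :+ con 0 :* x))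
          refl x

  0≤1 : 0# ≤ 1#
  0≤1 = ≤-respʳ-≈ (*-identityˡ 1#) (0≤x² 1#)

  1≰0 : ¬ 1# ≤ 0#
  1≰0 1≤0 = 0≉1 (antisym 0≤1 1≤0)

  1≤⇒≉0 : ∀ {x} → 1# ≤ x → ¬ x ≈ 0#
  1≤⇒≉0 1≤x x≈0 = 1≰0 (≤-respʳ-≈ x≈0 1≤x)

  ⁻¹-nonNeg : ∀ {x} → 0# ≤ x → ¬ x ≈ 0# → 0# ≤ x ⁻¹
  ⁻¹-nonNeg {x} 0≤x x≉0 with total 0# (x ⁻¹)
  ... | inj₁ 0≤x⁻¹ = 0≤x⁻¹
  ... | inj₂ x⁻¹≤0 = contradiction
    (≤-resp₂ (*-inverseʳ x≉0) (trans (*-comm x 0#) (zeroˡ x)) (*-monoʳ-≤ 0≤x x⁻¹≤0)) 1≰0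

  -- If y ≤ x, then (z - 1)(x - y) ≥ 0, and adding this to the hypothesis leaves x ≤ y. No inverse
  -- of `z` is involved.
  *-cancelˡ-≤ : ∀ {z x y} → 1# ≤ z → z * x ≤ z * y → x ≤ y
  *-cancelˡ-≤ {z} {x} {y} 1≤z zx≤zy with total x y
  ... | inj₁ x≤y = x≤y
  ... | inj₂ y≤x = ≤-by (+-mono-≤ zx≤zy (rearrangement 1≤z y≤x)) $
    solve 3 (λ z x y → x :+ (z :* y :+ (con 1 :* y :+ z :* x))
                    := y :+ (z :* x :+ (con 1 :* x :+ z :* y)))
          refl z x y

  -- Finite sums, maxima and inner products.

  sum-mono-≤ : ∀ {n} {x y : Vector Carrier n} → (∀ i → x i ≤ y i) → sum x ≤ sum y
  sum-mono-≤ {ℕ.zero} x≤y = ≤-refl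
  sum-mono-≤ {suc n}  x≤y = +-mono-≤ (x≤y zero) (sum-mono-≤ (x≤y ∘ suc))

  sum-nonNeg : ∀ {n} {x : Vector Carrier n} → (∀ i → 0# ≤ x i) → 0# ≤ sum x
  sum-nonNeg {ℕ.zero} 0≤x = ≤-refl
  sum-nonNeg {suc n}  0≤x =
    ≤-respˡ-≈ (+-identityˡ 0#) (+-mono-≤ (0≤x zero) (sum-nonNeg (0≤x ∘ suc)))

  sum-nonPos : ∀ {n} {x : Vector Carrier n} → (∀ i → x i ≤ 0#) → sum x ≤ 0#
  sum-nonPos {ℕ.zero} x≤0 = ≤-refl
  sum-nonPos {suc n}  x≤0 =
    ≤-respʳ-≈ (+-identityˡ 0#) (+-mono-≤ (x≤0 zero) (sum-nonPos (x≤0 ∘ suc)))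

  term≤sum : ∀ {n} {x : Vector Carrier n} → (∀ i → 0# ≤ x i) → ∀ i → x i ≤ sum x
  term≤sum {suc n} {x} 0≤x i = ≤-by (sum-nonNeg (0≤x ∘ punchIn i)) $
    trans (sym (sum-remove {i = i} x)) (sym (+-identityʳ _))

  sum≤term : ∀ {n} {x : Vector Carrier n} → (∀ i → x i ≤ 0#) → ∀ i → sum x ≤ x i
  sum≤term {suc n} {x} x≤0 i = ≤-by (sum-nonPos (x≤0 ∘ punchIn i)) $
    trans (+-identityʳ _) (sum-remove {i = i} x)

  argmax : ∀ {n} (x : Vector Carrier (suc n)) → ∃ λ i → ∀ j → x j ≤ x i
  argmax {ℕ.zero} x = zero , λ { zero → ≤-refl }
  argmax {suc n}  x with argmax (x ∘ suc)
  ... | i , max with total (x zero) (x (suc i))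
  ...   | inj₁ x₀≤xᵢ = suc i , λ { zero → x₀≤xᵢ ; (suc j) → max j }
  ...   | inj₂ xᵢ≤x₀ = zero  , λ { zero → ≤-refl ; (suc j) → ≤-trans (max j) xᵢ≤x₀ }

  infixl 8 _∙_
  _∙_ : ∀ {n} → Vector Carrier n → Vector Carrier n → Carrier
  x ∙ y = sum (λ i → x i * y i)

  ∙-remove : ∀ {n} (x y : Vector Carrier (suc n)) i →
             x ∙ y ≈ x i * y i + removeAt x i ∙ removeAt y i
  ∙-remove x y i = sum-remove {i = i} (λ l → x l * y l)

  sum-linear : ∀ {n} p q (x y : Vector Carrier n) →
               sum (λ i → p * x i + q * y i) ≈ p * sum x + q * sum y
  sum-linear p q x y = trans (∑-distrib-+ (λ i → p * x i) (λ i → q * y i))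
    (sym (+-cong (*-distribˡ-sum p x) (*-distribˡ-sum q y)))

  sum-affine : ∀ {n} p q (x : Vector Carrier n) →
               sum (λ i → p * x i + q) ≈ p * sum x + fromℕ n * q
  sum-affine {n} p q x = trans (∑-distrib-+ (λ i → p * x i) (λ _ → q))
    (+-cong (sym (*-distribˡ-sum p x))
            (trans (sum-replicate n)
                   (sym (trans (×-assoc-* n 1# q) (SemiringMult.×-congʳ semiring n (*-identityˡ q))))))

  -- The numerical inequality behind a greedy step.

  -- With g = 1 + c and u = yⱼ + z the
  -- inequality is Σᵢ (2gyᵢ − u)² ≥ ku², which already the two terms yⱼ and z
  -- guarantee, since the sum of their squares is at least (2gu − 2u)²/2 = 2c²u².
  pair-bound : ∀ {m} (y : Vector Carrier (suc (suc m))) j l {c} → 0# ≤ c →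
               c * c + c * c ≈ fromℕ (suc (suc m)) →
               (y j + y (punchIn j l)) * sum y ≤ (1# + c) * (y ∙ y)
  pair-bound {m} y j l {c} 0≤c 2c²≈k = *-cancelˡ-≤ 1≤4g $
    ≤-resp₂ (*-congˡ (*-congˡ (sym sum-y))) (*-congˡ (*-congˡ (sym sum-yy))) $
    -- `others` is (2gv - u)² ≥ 0 summed over the m entries outside the pair, `pair` is (yⱼ + z)² ≤
    -- 2(yⱼ² + z²) times 2g², and the last summand trades k = m + 2 for 2c².
    ≤-by (+-mono-≤ others (+-mono-≤ pair (≤-reflexive (*-congʳ (sym 2c²≈k))))) $
    solve 6 (λ c x z w q μ → let g = con 1 :+ c
                                 u = x :+ z
                                 4g = g :+ (g :+ (g :+ g))
                                 s = λ v → v :* v in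
        4g :* (u :* (x :+ (z :+ w)))
          :+ ((4g :* g :* q :+ μ :* s u)
            :+ ((s (g :+ g) :* (s x :+ s z)) :+ (s c :+ s c) :* s u))
        := 4g :* (g :* (s x :+ (s z :+ q)))
          :+ (4g :* u :* w
            :+ ((g :* (g :+ g)) :* s u :+ (con 1 :+ (con 1 :+ μ)) :* s u)))
      refl c (y j) z (sum rest) (rest ∙ rest) (fromℕ m)
    where
    g  = 1# + c
    4g = g + (g + (g + g))
    z  = y (punchIn j l)
    u  = y j + z
    rest = removeAt (removeAt y j) l

    sum-y : sum y ≈ y j + (z + sum rest)
    sum-y = trans (sum-remove {i = j} y) (+-congˡ (sum-remove {i = l} (removeAt y j)))

    sum-yy : y ∙ y ≈ y j * y j + (z * z + rest ∙ rest)
    sum-yy = trans (∙-remove y y j) (+-congˡ (∙-remove (removeAt y j) (removeAt y j) l))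

    1≤4g : 1# ≤ 4g
    1≤4g = ≤-by (+-mono-≤ 0≤c (+-mono-≤ 0≤g (+-mono-≤ 0≤g 0≤g))) $
      solve 1 (λ c → let g = con 1 :+ c in
        con 1 :+ (c :+ (g :+ (g :+ g)))
        := (g :+ (g :+ (g :+ g))) :+ (con 0 :+ (con 0 :+ (con 0 :+ con 0))))
        refl c
      where
      0≤g : 0# ≤ g
      0≤g = ≤-respˡ-≈ (+-identityˡ 0#) (+-mono-≤ 0≤1 0≤c)

    term : ∀ v → 4g * u * v ≤ 4g * g * (v * v) + u * u
    term v = ≤-by (2xy≤x²+y² ((g + g) * v) u) $
      solve 3 (λ g u v → let 4g = g :+ (g :+ (g :+ g))
                             p = (g :+ g) :* v in
        4g :* u :* v :+ (p :* p :+ u :* u)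
        := (4g :* g :* (v :* v) :+ u :* u) :+ (p :* u :+ u :* p))
        refl g u v

    others : 4g * u * sum rest ≤ 4g * g * (rest ∙ rest) + fromℕ m * (u * u)
    others = ≤-resp₂ (sym (*-distribˡ-sum (4g * u) rest))
      (sum-affine (4g * g) (u * u) (λ i → rest i * rest i))
      (sum-mono-≤ (term ∘ rest))

    pair : (g * (g + g)) * (u * u) ≤ (g + g) * (g + g) * (y j * y j + z * z)
    pair = ≤-by (*-monoʳ-≤ 0≤g[g+g] (2xy≤x²+y² (y j) z)) $
      solve 3 (λ g x z → let u = x :+ z in
        (g :* (g :+ g)) :* (u :* u) :+ (g :* (g :+ g)) :* (x :* x :+ z :* z)
        := (g :+ g) :* (g :+ g) :* (x :* x :+ z :* z) :+ (g :* (g :+ g)) :* (x :* z :+ z :* x))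
        refl g (y j) z
      where
      0≤g[g+g] : 0# ≤ g * (g + g)
      0≤g[g+g] = ≤-resp₂ (+-identityˡ 0#) (sym (distribˡ g g g)) (+-mono-≤ (0≤x² g) (0≤x² g))


  exchange-bound : ∀ {m} (y a : Vector Carrier (suc (suc m))) j {c} → 0# ≤ c →
                   c * c + c * c ≈ fromℕ (suc (suc m)) →
                   (∀ i → 0# ≤ y i) → (∀ i → a i ≤ y i) → 0# ≤ sum a →
                   sum y * a j ≤ y ∙ a + c * (y ∙ y)
  exchange-bound y a j {c} 0≤c 2c²≈k 0≤y a≤y 0≤Σa =
    ≤-resp₂ (*-congʳ (sym (sum-remove {i = j} y)))
            (sym (+-cong (∙-remove y a j) (*-congˡ (∙-remove y y j)))) $
    -- After cancelling yⱼaⱼ, `others` replaces the products yᵢaᵢ with i ≠ j by a multiple -z of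
    -- Σ_{i≠j} aᵢ, `balance` bounds that by z aⱼ, and `at-j` turns aⱼ into yⱼ. What remains is (yⱼ +
    -- z) Σ yᵢ - Σ yᵢ², which `pair` bounds. In the identity β is the sum over i ≠ j only.
    ≤-by (+-mono-≤ others (+-mono-≤ balance (+-mono-≤ at-j pair))) $
    solve 8 (λ c x z aⱼ β A P Q →
        (x :+ β) :* aⱼ
          :+ ((z :* β :+ con 1 :* P)
            :+ (z :* (aⱼ :+ A)
            :+ ((β :+ z) :* x
            :+ (con 1 :+ c) :* (x :* x :+ Q))))
        := (x :* aⱼ :+ P) :+ c :* (x :* x :+ Q)
          :+ ((z :* A :+ con 1 :* Q)
            :+ (z :* con 0
            :+ ((β :+ z) :* aⱼ
            :+ (x :+ z) :* (x :+ β)))))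
      refl c (y j) z (a j) (sum y′) (sum a′) (y′ ∙ a′) (y′ ∙ y′)
    where
    y′ = removeAt y j
    a′ = removeAt a j
    l  = proj₁ (argmax y′)
    z  = y′ l

    0≤z : 0# ≤ z
    0≤z = 0≤y (punchIn j l)

    -- This is (z - yᵢ)(yᵢ - aᵢ) ≥ 0, the place where z must be maximal among the labels other than
    -- j. The factors `1#` fit the shape of `sum-linear`.
    term : ∀ i → z * a′ i + 1# * (y′ i * y′ i) ≤ z * y′ i + 1# * (y′ i * a′ i)
    term i = ≤-by (rearrangement (a≤y (punchIn j i)) (proj₂ (argmax y′) i)) $
      solve 3 (λ z a y → (z :* a :+ con 1 :* (y :* y)) :+ (a :* y :+ y :* z)
                      := (z :* y :+ con 1 :* (y :* a)) :+ (a :* z :+ y :* y))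
            refl z (a′ i) (y′ i)

    others : z * sum a′ + 1# * (y′ ∙ y′) ≤ z * sum y′ + 1# * (y′ ∙ a′)
    others = ≤-resp₂ (sum-linear z 1# a′ (λ i → y′ i * y′ i))
                     (sum-linear z 1# y′ (λ i → y′ i * a′ i))
                     (sum-mono-≤ term)

    balance : z * 0# ≤ z * (a j + sum a′)
    balance = *-monoʳ-≤ 0≤z (≤-respʳ-≈ (sum-remove {i = j} a) 0≤Σa)

    at-j : (sum y′ + z) * a j ≤ (sum y′ + z) * y j
    at-j = *-monoʳ-≤
      (≤-respˡ-≈ (+-identityˡ 0#) (+-mono-≤ (sum-nonNeg (0≤y ∘ punchIn j)) 0≤z)) (a≤y j)

    pair : (y j + z) * (y j + sum y′) ≤ (1# + c) * (y j * y j + y′ ∙ y′)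
    pair = ≤-resp₂ (*-congˡ (sum-remove {i = j} y)) (*-congˡ (∙-remove y y j))
                   (pair-bound y j l 0≤c 2c²≈k)

  -- Weighted means, positive parts and the constant √(k/2).

  x/y*z : ∀ x y z → x / y * z ≈ y ⁻¹ * (x * z)
  x/y*z x y z = trans (*-congʳ (*-comm x (y ⁻¹))) (*-assoc (y ⁻¹) x z)

  ⁻¹-cancelˡ : ∀ {x} → ¬ x ≈ 0# → ∀ y → x ⁻¹ * (x * y) ≈ y
  ⁻¹-cancelˡ {x} x≉0 y =
    trans (sym (*-assoc (x ⁻¹) x y))
      (trans (*-congʳ (trans (*-comm (x ⁻¹) x) (*-inverseʳ x≉0))) (*-identityˡ y))

  -- Multiplying by the nonnegative `b ⁻¹` gives the claim, so a bound on a normalised mean can be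
  -- proved in a form free of division.
  ≤-weightedMean : ∀ {n} (w x : Vector Carrier n) {b y} → 0# ≤ b → ¬ b ≈ 0# →
                   b * y ≤ w ∙ x → y ≤ sum (λ i → w i / b * x i)
  ≤-weightedMean w x {b} {y} 0≤b b≉0 by≤w∙x =
    ≤-resp₂ (⁻¹-cancelˡ b≉0 y)
            (trans (*-distribˡ-sum (b ⁻¹) (λ i → w i * x i))
                   (sum-cong-≋ (λ i → sym (x/y*z (w i) b (x i)))))
            (*-monoʳ-≤ (⁻¹-nonNeg 0≤b b≉0) by≤w∙x)

  max-nonNeg : ∀ x → 0# ≤ max 0# x
  max-nonNeg x = x≤x⊔y 0# x

  x≤max : ∀ x → x ≤ max 0# x
  x≤max x = x≤y⊔x 0# x

  -- The maximum is either `0#` or `x`. Hence the gains at the current solution, weighted by their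
  -- positive parts, sum to Σ yᵢ².
  max*x≈max² : ∀ x → max 0# x * x ≈ max 0# x * max 0# x
  -- `max 0# x` computes by this same comparison, so each case reduces it.
  max*x≈max² x with total x 0#
  ... | inj₁ _ = trans (zeroˡ x) (sym (zeroˡ 0#))
  ... | inj₂ _ = refl

  half-square : ∀ {x} → IsSqrt (fromℕ n / fromℕ 2) x → x * x + x * x ≈ fromℕ n
  half-square {n} {x} (_ , x²≈n/2) = begin
    x * x + x * x                     ≈⟨ solve 1 (λ s → s :+ s := two :* s) refl (x * x) ⟩
    fromℕ 2 * (x * x)                 ≈⟨ *-congˡ x²≈n/2 ⟩
    fromℕ 2 * (fromℕ n / fromℕ 2)     ≈⟨ *-congˡ (*-comm _ _) ⟩
    fromℕ 2 * (fromℕ 2 ⁻¹ * fromℕ n)  ≈⟨ *-assoc _ _ _ ⟨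
    fromℕ 2 * fromℕ 2 ⁻¹ * fromℕ n    ≈⟨ *-congʳ (*-inverseʳ 2≉0) ⟩
    1# * fromℕ n                      ≈⟨ *-identityˡ _ ⟩
    fromℕ n                           ∎
    where
    open SetoidReasoning setoid

    -- Mirrors `fromℕ 2`, which unfolds to `1# + (1# + 0#)`.
    two : ∀ {m} → Polynomial m
    two = con 1 :+ (con 1 :+ con 0)

    2≉0 : ¬ fromℕ 2 ≈ 0#
    2≉0 = 1≤⇒≉0 (≤-by 0≤1 (solve 0 (con 1 :+ con 1 := two :+ con 0) refl))

-- `min₀` and `max₀` at zero and at equal entries.

module _ {k : ℕ} where
  open Min (Fin.≤-totalOrder (suc k)) using (x≤y⇒x⊓y≈x; x≤y⇒y⊓x≈x; ⊓-idem)
  open Max (Fin.≤-totalOrder (suc k)) using (x≤y⇒x⊔y≈y; x≤y⇒y⊔x≈y; ⊔-idem)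

  min₀-zeroˡ : ∀ t → min₀ {k} zero t ≡ zero
  min₀-zeroˡ t = x≤y⇒x⊓y≈x {y = t} z≤n

  min₀-zeroʳ : ∀ t → min₀ {k} t zero ≡ zero
  min₀-zeroʳ zero    = ⊓-idem zero
  min₀-zeroʳ (suc t) = x≤y⇒y⊓x≈x {y = suc t} z≤n

  min₀-idem : ∀ t → min₀ {k} t t ≡ t
  min₀-idem t with t Fin.≟ zero | t Fin.≟ t
  ... | yes _ | _     = ⊓-idem t
  ... | no _  | yes _ = ⊓-idem t
  ... | no _  | no t≢t = contradiction ≡.refl t≢t

  max₀-zeroˡ : ∀ t → max₀ {k} zero t ≡ t
  max₀-zeroˡ t = x≤y⇒x⊔y≈y {x = t} z≤n

  max₀-zeroʳ : ∀ t → max₀ {k} t zero ≡ t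
  max₀-zeroʳ zero    = ⊔-idem zero
  max₀-zeroʳ (suc t) = x≤y⇒y⊔x≈y {x = suc t} z≤n

  max₀-idem : ∀ t → max₀ {k} t t ≡ t
  max₀-idem t with t Fin.≟ zero | t Fin.≟ t
  ... | yes _ | _     = ⊔-idem t
  ... | no _  | yes _ = ⊔-idem t
  ... | no _  | no t≢t = contradiction ≡.refl t≢t

-- Updating one coordinate of a partial solution.

module _ {n : ℕ} (e : Fin n) where

  -- The motive sees the coordinate as well as the entry, because `_InOrthant_` compares the entry
  -- with that of another vector at the same place.
  update-elim : (P : Fin n → A → Set) (xs : Vec A n) (x : A) → P e x →
                (∀ d → d ≢ e → P d (lookup xs d)) → ∀ d → P d (lookup (xs [ e ]≔ x) d)
  update-elim P xs x pe pd d with d Fin.≟ e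
  ... | yes ≡.refl = ≡.subst (P e) (≡.sym (lookup∘update e xs x)) pe
  ... | no d≢e     = ≡.subst (P d) (≡.sym (lookup∘update′ d≢e xs x)) (pd d d≢e)

  update-orthant : (o : PartialSolution k n) → IsOrthant o → ∀ i → IsOrthant (o [ e ]≔ suc i)
  update-orthant o o-orthant i =
    update-elim (λ _ x → x ≢ zero) o (suc i) (λ ()) (λ d _ → o-orthant d)

  zipWith-update : (_⊕_ : A → A → A) (xs ys zs : Vec A n) (x y : A) →
                   x ⊕ y ≡ lookup zs e →
                   (∀ d → d ≢ e → lookup xs d ⊕ lookup ys d ≡ lookup zs d) →
                   zipWith _⊕_ (xs [ e ]≔ x) (ys [ e ]≔ y) ≡ zs
  zipWith-update _⊕_ xs ys zs x y at-e off-e = Pointwise-≡⇒≡ (ext λ d →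
    ≡.trans (lookup-zipWith _⊕_ d (xs [ e ]≔ x) (ys [ e ]≔ y)) (pointwise d))
    where
    pointwise : ∀ d → lookup (xs [ e ]≔ x) d ⊕ lookup (ys [ e ]≔ y) d ≡ lookup zs d
    pointwise d with d Fin.≟ e
    ... | yes ≡.refl = ≡.trans (≡.cong₂ _⊕_ (lookup∘update e xs x) (lookup∘update e ys y)) at-e
    ... | no d≢e     =
      ≡.trans (≡.cong₂ _⊕_ (lookup∘update′ d≢e xs x) (lookup∘update′ d≢e ys y)) (off-e d d≢e)

module _ (s o : PartialSolution k n) (s∈o : s InOrthant o)
         (e : Fin n) (sₑ≡0 : lookup s e ≡ zero) where

  -- Off `e` each entry of `s` is zero or equals that of `o`, so `min₀` returns the entry of `s`; at
  -- `e` the erased zero wins, as in `s`. `max₀-update` is dual: `o` wins off `e`, the new label at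
  -- `e`.
  min₀-update : ∀ i → zipWith min₀ (s [ e ]≔ suc i) (o [ e ]≔ zero) ≡ s
  min₀-update i = zipWith-update e min₀ s o s (suc i) zero
    (≡.trans (min₀-zeroʳ (suc i)) (≡.sym sₑ≡0)) (λ d _ → off-e d)
    where
    off-e : ∀ d → min₀ (lookup s d) (lookup o d) ≡ lookup s d
    off-e d with lookup s d | s∈o d
    ... | _ | inj₁ ≡.refl = min₀-zeroˡ (lookup o d)
    ... | _ | inj₂ ≡.refl = min₀-idem (lookup o d)

  max₀-update : ∀ i → zipWith max₀ (s [ e ]≔ suc i) (o [ e ]≔ zero) ≡ o [ e ]≔ suc i
  max₀-update i = zipWith-update e max₀ s o (o [ e ]≔ suc i) (suc i) zero
    (≡.trans (max₀-zeroʳ (suc i)) (≡.sym (lookup∘update e o (suc i))))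
    (λ d d≢e → ≡.trans (off-e d) (≡.sym (lookup∘update′ d≢e o (suc i))))
    where
    off-e : ∀ d → max₀ (lookup s d) (lookup o d) ≡ lookup o d
    off-e d with lookup s d | s∈o d
    ... | _ | inj₁ ≡.refl = max₀-zeroˡ (lookup o d)
    ... | _ | inj₂ ≡.refl = max₀-idem (lookup o d)

  update-inOrthant : ∀ i → (s [ e ]≔ suc i) InOrthant (o [ e ]≔ suc i)
  update-inOrthant i = update-elim e (λ d x → x ≡ zero ⊎ x ≡ lookup (o [ e ]≔ suc i) d) s (suc i)
    (inj₂ (≡.sym (lookup∘update e o (suc i))))
    (λ d d≢e → map₂ (λ eq → ≡.trans eq (≡.sym (lookup∘update′ d≢e o (suc i)))) (s∈o d))

erase-inOrthant : (o : PartialSolution k n) (e : Fin n) (i : Fin k) →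
                  (o [ e ]≔ zero) InOrthant (o [ e ]≔ suc i)
erase-inOrthant o e i =
  update-elim e (λ d x → x ≡ zero ⊎ x ≡ lookup (o [ e ]≔ suc i) d) o zero
    (inj₁ ≡.refl) (λ d d≢e → inj₂ (≡.sym (lookup∘update′ d≢e o (suc i))))

module _ (F : OrderedField c ℓ₁ ℓ₂) where
  open OrderedField F
  open OrderedFieldProperties F
  open CommutativeRing commutativeRing
    using (commutativeSemiring; semiring; refl; sym; trans; reflexive;
           +-cong; +-congˡ; +-congʳ; *-congˡ; +-assoc; +-comm;
           +-identityˡ; +-identityʳ; *-identityˡ; zeroʳ; *-assoc; distribˡ)
  open SemiringSum semiring using (∑-distrib-+; sum-cong-≋; *-distribˡ-sum; *-distribʳ-sum)
  open Solver commutativeSemiring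

  -- Expectations over finite distributions.

  expectation-++ : (d₁ d₂ : Dist F A) (g : A → Carrier) →
                   expectation F (d₁ ++ d₂) g ≈ expectation F d₁ g + expectation F d₂ g
  expectation-++ []             d₂ g = sym (+-identityˡ _)
  expectation-++ ((p , x) ∷ d₁) d₂ g =
    trans (+-congˡ (expectation-++ d₁ d₂ g)) (sym (+-assoc _ _ _))

  expectation-scale : ∀ p (d : Dist F A) (g : A → Carrier) →
                      expectation F (map (λ (q , y) → p * q , y) d) g ≈ p * expectation F d g
  expectation-scale p []            g = sym (zeroʳ p)
  expectation-scale p ((q , y) ∷ d) g =
    trans (+-cong (*-assoc p q (g y)) (expectation-scale p d g)) (sym (distribˡ p _ _))

  expectation->>= : (d : Dist F A) (h : A → Dist F B) (g : B → Carrier) →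
                    expectation F (_>>=_ F d h) g ≈ expectation F d (λ x → expectation F (h x) g)
  expectation->>= []            h g = refl
  expectation->>= ((p , x) ∷ d) h g =
    trans (expectation-++ (map (λ (q , y) → p * q , y) (h x)) _ g)
          (+-cong (expectation-scale p (h x) g) (expectation->>= d h g))

  expectation-return : (x : A) (g : A → Carrier) → expectation F (return F x) g ≈ g x
  expectation-return x g = trans (+-identityʳ _) (*-identityˡ (g x))

  expectation-tabulate : ∀ {n} (p : Fin n → Carrier) (x : Fin n → A) (g : A → Carrier) →
                         expectation F (tabulate (λ i → p i , x i)) g ≡ sum (λ i → p i * g (x i))
  expectation-tabulate {n = ℕ.zero} p x g = ≡.refl
  expectation-tabulate {n = suc n}  p x g =
    ≡.cong (p zero * g (x zero) +_) (expectation-tabulate (p ∘ suc) (x ∘ suc) g)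

  -- Submodularity as diminishing returns.

  module _ {f : PartialSolution k n → Carrier} (submodular : SubmodularInEveryOrthant F f) where

    -- Submodularity is applied to `s [ e ]≔ suc i` and `o [ e ]≔ zero`. Erasing `e` puts both into
    -- the orthant `o [ e ]≔ suc i` whatever label `o` has at `e`; their `min₀` is `s` and their
    -- `max₀` is that orthant.
    diminishing-returns : ∀ {s o} → IsOrthant o → s InOrthant o → ∀ e → lookup s e ≡ zero → ∀ i →
                          marginal F f e (o [ e ]≔ zero) i ≤ marginal F f e s i
    diminishing-returns {s} {o} o-orthant s∈o e sₑ≡0 i =
      +-cancelʳ-≤ (f s + f (o [ e ]≔ zero)) $
      ≤-resp₂ (regroup₁ _ _ _) (regroup₂ _ _ _) inequality
      where
      inequality : f s + f (o [ e ]≔ zero [ e ]≔ suc i) ≤ f (s [ e ]≔ suc i) + f (o [ e ]≔ zero)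
      inequality = ≤-respˡ-≈
        (reflexive (≡.cong₂ (λ x y → f x + f y) (min₀-update s o s∈o e sₑ≡0 i)
          (≡.trans (max₀-update s o s∈o e sₑ≡0 i) (≡.sym ([]≔-idempotent o e)))))
        (submodular (o [ e ]≔ suc i) (update-orthant e o o-orthant i)
          (s [ e ]≔ suc i) (o [ e ]≔ zero)
          (update-inOrthant s o s∈o e sₑ≡0 i) (erase-inOrthant o e i))

      regroup₁ : ∀ x y z → y + z ≈ (z - x) + (y + x)
      regroup₁ x y z = trans (+-comm y z) (trans (+-congʳ (sym (x-y+y≈x z x)))
        (solve 3 (λ d x y → (d :+ x) :+ y := d :+ (y :+ x)) refl (z - x) x y))

      regroup₂ : ∀ x y z → z + x ≈ (z - y) + (y + x)
      regroup₂ x y z = trans (+-congʳ (sym (x-y+y≈x z y))) (+-assoc _ y x)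

  -- The change of the potential in one greedy step.

  module GreedyStep
    {m n : ℕ} {f : PartialSolution (suc (suc m)) n → Carrier}
    (submodular : SubmodularInEveryOrthant F f) (monotone : KWiseMonotone F f)
    {c : Carrier} (0≤c : 0# ≤ c) (2c²≈k : c * c + c * c ≈ fromℕ (suc (suc m)))
    {s o : PartialSolution (suc (suc m)) n} (o-orthant : IsOrthant o) (s∈o : s InOrthant o)
    (e : Fin n) (sₑ≡0 : lookup s e ≡ zero)
    where

    private
      t = o [ e ]≔ zero

      a r y : Vector Carrier (suc (suc m))
      a = marginal F f e t
      r = marginal F f e s
      y = max 0# ∘ r

      β = sum y

      label : ∀ {x : Fin (suc k)} → x ≢ zero → ∃ λ j → x ≡ suc j
      label {x = zero}  x≢0 = contradiction ≡.refl x≢0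
      label {x = suc j} _   = j , ≡.refl

      j = proj₁ (label (o-orthant e))

      0≤y : ∀ i → 0# ≤ y i
      0≤y i = max-nonNeg (r i)

      0≤β : 0# ≤ β
      0≤β = sum-nonNeg 0≤y

      a≤r : ∀ i → a i ≤ r i
      a≤r = diminishing-returns submodular o-orthant s∈o e sₑ≡0

      a≤y : ∀ i → a i ≤ y i
      a≤y i = ≤-trans (a≤r i) (x≤max (r i))

      0≤Σa : 0# ≤ sum a
      0≤Σa = monotone e t (lookup∘update e o zero)

      f-hybrid : ∀ i → a i + f t ≈ f (o [ e ]≔ suc i)
      f-hybrid i = trans (x-y+y≈x _ _) (reflexive (≡.cong f ([]≔-idempotent o e)))

      f-current : ∀ i → r i + f s ≈ f (s [ e ]≔ suc i)
      f-current i = x-y+y≈x _ _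

      f-o : a j + f t ≈ f o
      f-o = trans (f-hybrid j) (reflexive (≡.cong f
        (≡.trans (≡.cong (o [ e ]≔_) (≡.sym (proj₂ (label (o-orthant e))))) ([]≔-lookup o e))))

      potential : PartialSolution (suc (suc m)) n → PartialSolution (suc (suc m)) n → Carrier
      potential o s = f o + c * f s

    -- With β = 0 every aᵢ is at most yᵢ = 0, while Σ aᵢ ≥ 0, so aⱼ ≤ 0 ≤ aᵢ ≤ rᵢ. Neither summand
    -- of the potential drops, for any label, so the default label is safe.
    potential-gainless : β ≈ 0# → ∀ i → potential o s ≤ potential (o [ e ]≔ suc i) (s [ e ]≔ suc i)
    potential-gainless β≈0 i = +-mono-≤
      (≤-resp₂ f-o (f-hybrid i) (+-monoˡ-≤ (f t) (≤-trans (a≤0 j) 0≤aᵢ)))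
      (*-monoʳ-≤ 0≤c (≤-resp₂ (+-identityˡ (f s)) (f-current i)
        (+-monoˡ-≤ (f s) (≤-trans 0≤aᵢ (a≤r i)))))
      where
      a≤0 : ∀ i → a i ≤ 0#
      a≤0 i = ≤-trans (a≤y i) (≤-respʳ-≈ β≈0 (term≤sum 0≤y i))

      0≤aᵢ : 0# ≤ a i
      0≤aᵢ = ≤-trans 0≤Σa (sum≤term a≤0 i)

    -- Multiply by β. The part `K` of the potential common to all labels cancels because the weights
    -- yᵢ sum to β; what is left is `exchange-bound`.
    potential-mean : ¬ β ≈ 0# →
      potential o s ≤ sum (λ i → y i / β * potential (o [ e ]≔ suc i) (s [ e ]≔ suc i))
    potential-mean β≉0 = ≤-weightedMean y
      (λ i → potential (o [ e ]≔ suc i) (s [ e ]≔ suc i)) 0≤β β≉0 $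
      ≤-resp₂ (*-congˡ (+-congʳ f-o)) (sym Σy*potential) $
      ≤-by (exchange-bound y a j 0≤c 2c²≈k 0≤y a≤y 0≤Σa) $
      solve 7 (λ c β aⱼ T S P Q →
          β :* ((aⱼ :+ T) :+ c :* S) :+ (P :+ c :* Q)
          := ((con 1 :* P :+ c :* Q) :+ β :* (T :+ c :* S)) :+ β :* aⱼ)
        refl c β (a j) (f t) (f s) (y ∙ a) (y ∙ y)
      where
      K = f t + c * f s

      y*potential : ∀ i → y i * potential (o [ e ]≔ suc i) (s [ e ]≔ suc i) ≈
                          (1# * (y i * a i) + c * (y i * y i)) + y i * K
      y*potential i = trans
        (*-congˡ (sym (+-cong (f-hybrid i) (*-congˡ (f-current i)))))
        (trans
          (solve 6 (λ c y a r T S →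
              y :* ((a :+ T) :+ c :* (r :+ S))
              := (con 1 :* (y :* a) :+ c :* (y :* r)) :+ y :* (T :+ c :* S))
            refl c (y i) (a i) (r i) (f t) (f s))
          (+-congʳ (+-congˡ (*-congˡ (max*x≈max² (r i))))))

      Σy*potential : y ∙ (λ i → potential (o [ e ]≔ suc i) (s [ e ]≔ suc i)) ≈
                     (1# * (y ∙ a) + c * (y ∙ y)) + β * K
      Σy*potential = trans (sum-cong-≋ y*potential) (trans
        (∑-distrib-+ (λ i → 1# * (y i * a i) + c * (y i * y i)) (λ i → y i * K))
        (+-cong (sum-linear 1# c (λ i → y i * a i) (λ i → y i * y i))
                (sym (*-distribʳ-sum K y))))

    -- `h` stands for the expected value of the rest of the run from a given solution. The
    -- hypothesis is the induction hypothesis for each label, each with its own hybrid.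
    potential-step : (h : PartialSolution (suc (suc m)) n → Carrier) →
      (∀ i → potential (o [ e ]≔ suc i) (s [ e ]≔ suc i) ≤ (1# + c) * h (s [ e ]≔ suc i)) →
      potential o s ≤ (1# + c) * expectation F (greedyStep F f e s) h
    potential-step h potential≤ with β ≟ 0#
    ... | yes β≈0 = ≤-respʳ-≈ (*-congˡ (sym (expectation-return _ h)))
      -- The index left to inference is that of `label₁`.
      (≤-trans (potential-gainless β≈0 _) (potential≤ _))
    ... | no β≉0 = ≤-respʳ-≈
      (trans (sym (trans (*-distribˡ-sum (1# + c) (λ i → y i / β * h (s [ e ]≔ suc i)))
                         (sum-cong-≋ (λ i → swap (1# + c) (y i / β) (h (s [ e ]≔ suc i))))))
             (*-congˡ (reflexive (≡.sym 
               (expectation-tabulate (λ i → y i / β) (λ i → s [ e ]≔ suc i) h)))))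
      (≤-trans (potential-mean β≉0)
        (sum-mono-≤ λ i → *-monoʳ-≤ (*-nonNeg (0≤y i) (⁻¹-nonNeg 0≤β β≉0)) (potential≤ i)))
      where
      swap : ∀ x y z → x * (y * z) ≈ y * (x * z)
      swap = solve 3 (λ x y z → x :* (y :* z) := y :* (x :* z)) refl

  -- Induction along the processing order.

  module _
    {m n : ℕ} {f : PartialSolution (suc (suc m)) n → Carrier}
    (submodular : SubmodularInEveryOrthant F f) (monotone : KWiseMonotone F f)
    {c : Carrier} (0≤c : 0# ≤ c) (2c²≈k : c * c + c * c ≈ fromℕ (suc (suc m)))
    where

    -- The list holds the unprocessed elements: `s` is zero on them and agrees with the hybrid `o`
    -- elsewhere. The statement ranges over all such `o`, since each step relabels the hybrid at
    -- `e`. Uniqueness keeps the remaining entries of `s` zero; at the empty list `s` and `o`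
    -- coincide.
    greedyFrom-bound : ∀ es {s o} → Unique es → IsOrthant o →
      All (λ e → lookup s e ≡ zero) es → (∀ e → e ∈ es ⊎ lookup s e ≡ lookup o e) →
      f o + c * f s ≤ (1# + c) * expectation F (greedyFrom F f s es) f
    greedyFrom-bound [] {s} {o} _ _ _ agree = ≤-reflexive $
      trans (+-congʳ (reflexive (≡.cong f (≡.sym s≡o))))
        (solve 2 (λ c S → S :+ c :* S := (con 1 :+ c) :* (con 1 :* S :+ con 0)) refl c (f s))
      where
      s≡o : s ≡ o
      s≡o = Pointwise-≡⇒≡ (ext λ e → [ (λ ()) , id ]′ (agree e))
    greedyFrom-bound (e ∷ es) {s} {o} (e∉es ∷ es-unique) o-orthant (sₑ≡0 ∷ s≡0) agree =
      ≤-respʳ-≈ (*-congˡ (sym (expectation->>= (greedyStep F f e s) _ f))) $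
      GreedyStep.potential-step submodular monotone 0≤c 2c²≈k o-orthant s∈o e sₑ≡0 _ λ i →
        greedyFrom-bound es es-unique (update-orthant e o o-orthant i)
          (All.zipWith (λ (e≢d , s_d≡0) → ≡.trans (lookup∘update′ (e≢d ∘ ≡.sym) s _) s_d≡0)
            (e∉es , s≡0))
          (agree-update i)
      where
      s∈o : s InOrthant o
      s∈o d = map₁ (All.lookup (sₑ≡0 ∷ s≡0)) (agree d)

      agree-update : ∀ i d → d ∈ es ⊎ lookup (s [ e ]≔ suc i) d ≡ lookup (o [ e ]≔ suc i) d
      agree-update i = update-elim e (λ d x → d ∈ es ⊎ x ≡ lookup (o [ e ]≔ suc i) d) s (suc i)
        (inj₂ (≡.sym (lookup∘update e o (suc i)))) off-e
        where
        off-e : ∀ d → d ≢ e → d ∈ es ⊎ lookup s d ≡ lookup (o [ e ]≔ suc i) d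
        off-e d d≢e with agree d
        ... | inj₁ (here d≡e)   = contradiction d≡e d≢e
        ... | inj₁ (there d∈es) = inj₁ d∈es
        ... | inj₂ s≡o          = inj₂ (≡.trans s≡o (≡.sym (lookup∘update′ d≢e o (suc i))))

theorem19 : ∀ {c ℓ₁ ℓ₂} (R : Reals c ℓ₁ ℓ₂) → let open Reals R in
    (k n : ℕ) .{{_ : NonTrivial k}} .{{_ : NonZero n}}
    (f : PartialSolution k n → Carrier) →
    NonNegative orderedField f →
    SubmodularInEveryOrthant orderedField f →
    KWiseMonotone orderedField f →
    (o : PartialSolution k n) → MaximisingOrthant orderedField f o →
    (order : List (Fin n)) → order ↭ allFin n →
    (√k/2 : Carrier) → IsSqrt (fromℕ k / fromℕ 2) √k/2 →
    f o ≤ (1# + √k/2) * expectation orderedField (randomizedGreedy orderedField f order) f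
theorem19 R 0 n {{()}}
theorem19 R 1 n {{()}}
theorem19 R k@(suc (suc _)) n f nonNeg submodular monotone
          o (o-orthant , _) order order↭ √k/2 isSqrt@(0≤√k/2 , _) =
  ≤-trans
    -- The initial potential f(o) + c f(0) is at least f(o), as c and f(0) are nonnegative.
    (≤-respˡ-≈ (trans (+-comm _ _) (+-identityˡ _))
      (+-mono-≤ ≤-refl (*-nonNeg 0≤√k/2 (nonNeg (replicate n zero)))))
    -- Initially nothing is processed, so the hybrid is `o` itself; a permutation of `allFin n`
    -- lists each element exactly once.
    (greedyFrom-bound orderedField submodular monotone 0≤√k/2 (half-square {n = k} isSqrt) order
      (Permutation.Unique-resp-↭ (≡.setoid (Fin n)) (↭⇒↭ₛ (↭-sym order↭)) (allFin⁺ n))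
      o-orthant
      (All.tabulate (λ {e} _ → lookup-replicate e zero))
      (λ e → inj₁ (∈-resp-↭ (↭-sym order↭) (∈-allFin e))))
  where
  open Reals R
  open OrderedFieldProperties orderedField
  open CommutativeRing commutativeRing using (trans; +-comm; +-identityˡ)
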